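{- Let $n$ be a positive integer. There exist a dihedral group $\Gamma$ of order $n^2$ and a $\Gamma$-semi-magic square $SMS_{\Gamma}(n)$ of side $n$ if and only if $n$ is even and $n\geq 4$.
   Context: The dihedral group $D_k$ ($k\ge 3$) is the group of order $2k$ with elements $r^0=e,r,r^2,\dots,r^{k-1}$ (rotations) and $s, rs,\dots,r^{k-1}s$ (reflections), where $r^k=e$, $(r^is)^2=e$ and $r^is=sr^{ -i}$. A dihedral group of order $n^2$ is $D_{n^2/2}$ (so $n$ must be even for such a group to exist). Let $\Gamma$ be a group of order $n^2$. A $\Gamma$-semi-magic square of side $n$, denoted $SMS_\Gamma(n)$, is an $n\times n$ array $(a_{i,j})$ whose entries are all the elements of $\Gamma$, each appearing exactly once, such that there is an element $\mu\in\Gamma$ (the magic constant) with the following property: for every row $i$ there is an ordering $j_1,\dots,j_n$ of the column indices (possibly depending on $i$) with $a_{i,j_1}a_{i,j_2}\cdots a_{i,j_n}=\mu$, and for every column $j$ there is an ordering $i_1,\dots,i_n$ of the row indices (possibly depending on $j$) with $a_{i_1,j}a_{i_2,j}\cdots a_{i_n,j}=\mu$. -}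

module Defs where

open import Algebra.Bundles using (Group; AbelianGroup; RawMonoid)
import Algebra.Definitions.RawMonoid as RawMonoidDefs
import Algebra.Properties.AbelianGroup as AbelianGroupProperties
open import Data.Fin.Base using (Fin; toℕ)
open import Data.Fin.Permutation using (Permutation′; _⟨$⟩ʳ_)
open import Data.Fin.Properties using (toℕ-fromℕ<; toℕ-injective; toℕ<n; toℕ≤n)
open import Data.Nat.Base using (ℕ; zero; suc; _+_; _∸_; _≤_; z≤n; s≤s; NonZero; >-nonZero)
open import Data.Nat.DivMod
  using (_%_; _mod_; m%n<n; %-distribˡ-+; m<n⇒m%n≡m; n%n≡0)
open import Data.Nat.Properties using (+-assoc; +-comm; m∸n+n≡m; ≤-trans)
open import Data.Product.Base using (Σ-syntax; _,_; uncurry)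
open import Function.Definitions using (Bijective)
open import Level using (Level; _⊔_; 0ℓ)
open import Relation.Binary.PropositionalEquality
  using (_≡_; refl; sym; trans; cong; cong₂; isEquivalence; module ≡-Reasoning)

open ≡-Reasoning

module ℤmod (k : ℕ) .{{_ : NonZero k}} where

  infixl 6 _⊕_ _⊖_
  infix 8 ⊝_

  0# : Fin k
  0# = 0 mod k

  _⊕_ : Fin k → Fin k → Fin k
  i ⊕ j = (toℕ i + toℕ j) mod k

  ⊝_ : Fin k → Fin k
  ⊝ i = (k ∸ toℕ i) mod k

  _⊖_ : Fin k → Fin k → Fin k
  i ⊖ j = i ⊕ ⊝ j

  toℕ-mod : ∀ m → toℕ (m mod k) ≡ m % k
  toℕ-mod m = toℕ-fromℕ< (m%n<n m k)

  toℕ-% : ∀ (i : Fin k) → toℕ i % k ≡ toℕ i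
  toℕ-% i = m<n⇒m%n≡m (toℕ<n i)

  mod-toℕ : ∀ (i : Fin k) → toℕ i mod k ≡ i
  mod-toℕ i = toℕ-injective (trans (toℕ-mod (toℕ i)) (toℕ-% i))

  mod-+ : ∀ m n → (m + n) mod k ≡ (m mod k) ⊕ (n mod k)
  mod-+ m n = toℕ-injective (begin
    toℕ ((m + n) mod k)                     ≡⟨ toℕ-mod (m + n) ⟩
    (m + n) % k                             ≡⟨ %-distribˡ-+ m n k ⟩
    (m % k + n % k) % k                     ≡⟨ cong₂ (λ x y → (x + y) % k) (toℕ-mod m) (toℕ-mod n) ⟨
    (toℕ (m mod k) + toℕ (n mod k)) % k     ≡⟨ toℕ-mod _ ⟨
    toℕ ((m mod k) ⊕ (n mod k))             ∎)

  ⊕-comm : ∀ i j → i ⊕ j ≡ j ⊕ i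
  ⊕-comm i j = cong (_mod k) (+-comm (toℕ i) (toℕ j))

  ⊕-assoc : ∀ i j l → (i ⊕ j) ⊕ l ≡ i ⊕ (j ⊕ l)
  ⊕-assoc i j l = begin
    (i ⊕ j) ⊕ l                             ≡⟨ cong ((i ⊕ j) ⊕_) (mod-toℕ l) ⟨
    (i ⊕ j) ⊕ (toℕ l mod k)                 ≡⟨ mod-+ (toℕ i + toℕ j) (toℕ l) ⟨
    (toℕ i + toℕ j + toℕ l) mod k           ≡⟨ cong (_mod k) (+-assoc (toℕ i) (toℕ j) (toℕ l)) ⟩
    (toℕ i + (toℕ j + toℕ l)) mod k         ≡⟨ mod-+ (toℕ i) (toℕ j + toℕ l) ⟩
    (toℕ i mod k) ⊕ (j ⊕ l)                 ≡⟨ cong (_⊕ (j ⊕ l)) (mod-toℕ i) ⟩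
    i ⊕ (j ⊕ l)                             ∎

  ⊕-identityˡ : ∀ i → 0# ⊕ i ≡ i
  ⊕-identityˡ i = begin
    0# ⊕ i                    ≡⟨ cong (0# ⊕_) (mod-toℕ i) ⟨
    0# ⊕ (toℕ i mod k)        ≡⟨ mod-+ 0 (toℕ i) ⟨
    toℕ i mod k               ≡⟨ mod-toℕ i ⟩
    i                         ∎

  ⊕-identityʳ : ∀ i → i ⊕ 0# ≡ i
  ⊕-identityʳ i = trans (⊕-comm i 0#) (⊕-identityˡ i)

  k-mod : k mod k ≡ 0#
  k-mod = toℕ-injective (begin
    toℕ (k mod k)   ≡⟨ toℕ-mod k ⟩
    k % k           ≡⟨ n%n≡0 k ⟩
    0               ≡⟨ m<n⇒m%n≡m (≤-trans (s≤s z≤n) (toℕ<n 0#)) ⟨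
    0 % k           ≡⟨ toℕ-mod 0 ⟨
    toℕ 0#          ∎)

  ⊝-inverseˡ : ∀ i → ⊝ i ⊕ i ≡ 0#
  ⊝-inverseˡ i = begin
    ⊝ i ⊕ i                       ≡⟨ cong (⊝ i ⊕_) (mod-toℕ i) ⟨
    ⊝ i ⊕ (toℕ i mod k)           ≡⟨ mod-+ (k ∸ toℕ i) (toℕ i) ⟨
    (k ∸ toℕ i + toℕ i) mod k     ≡⟨ cong (_mod k) (m∸n+n≡m (toℕ≤n i)) ⟩
    k mod k                       ≡⟨ k-mod ⟩
    0#                            ∎

  ⊝-inverseʳ : ∀ i → i ⊖ i ≡ 0#
  ⊝-inverseʳ i = trans (⊕-comm i (⊝ i)) (⊝-inverseˡ i)

  abelianGroup : AbelianGroup 0ℓ 0ℓ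
  abelianGroup = record
    { Carrier = Fin k
    ; _≈_ = _≡_
    ; _∙_ = _⊕_
    ; ε = 0#
    ; _⁻¹ = ⊝_
    ; isAbelianGroup = record
      { isGroup = record
        { isMonoid = record
          { isSemigroup = record
            { isMagma = record { isEquivalence = isEquivalence ; ∙-cong = cong₂ _⊕_ }
            ; assoc = ⊕-assoc
            }
          ; identity = ⊕-identityˡ , ⊕-identityʳ
          }
        ; inverse = ⊝-inverseˡ , ⊝-inverseʳ
        ; ⁻¹-cong = cong ⊝_
        }
      ; comm = ⊕-comm
      }
    }

  open AbelianGroupProperties abelianGroup public
    using () renaming (⁻¹-∙-comm to ⊝-⊕-comm; ⁻¹-involutive to ⊝-involutive)

  ⊕-⊖-assoc : ∀ i j l → (i ⊕ j) ⊖ l ≡ i ⊕ (j ⊖ l)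
  ⊕-⊖-assoc i j l = ⊕-assoc i j (⊝ l)

  ⊖-⊕ : ∀ i j l → (i ⊖ j) ⊖ l ≡ i ⊖ (j ⊕ l)
  ⊖-⊕ i j l = trans (⊕-assoc i (⊝ j) (⊝ l)) (cong (i ⊕_) (⊝-⊕-comm j l))

  ⊖-⊖ : ∀ i j l → (i ⊖ j) ⊕ l ≡ i ⊖ (j ⊖ l)
  ⊖-⊖ i j l = begin
    (i ⊖ j) ⊕ l           ≡⟨ cong ((i ⊖ j) ⊕_) (⊝-involutive l) ⟨
    (i ⊖ j) ⊖ ⊝ l         ≡⟨ ⊖-⊕ i j (⊝ l) ⟩
    i ⊖ (j ⊖ l)           ∎

-- rot i is the rotation rⁱ and ref i is the reflection rⁱs.
data Dihedral (k : ℕ) : Set where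
  rot ref : Fin k → Dihedral k

module _ (k : ℕ) .{{_ : NonZero k}} where

  open ℤmod k

  private
    infixl 7 _·_

    -- The multiplication table forced by rᵏ = e, s² = e and s rʲ = r⁻ʲ s.
    _·_ : Dihedral k → Dihedral k → Dihedral k
    rot i · rot j = rot (i ⊕ j)
    rot i · ref j = ref (i ⊕ j)
    ref i · rot j = ref (i ⊖ j)
    ref i · ref j = rot (i ⊖ j)

    inv : Dihedral k → Dihedral k
    inv (rot i) = rot (⊝ i)
    inv (ref i) = ref i

    e : Dihedral k
    e = rot 0#

    ⊝0 : ⊝ 0# ≡ 0#
    ⊝0 = trans (sym (⊕-identityˡ (⊝ 0#))) (⊝-inverseʳ 0#)

    ·-assoc : ∀ x y z → (x · y) · z ≡ x · (y · z)
    ·-assoc (rot i) (rot j) (rot l) = cong rot (⊕-assoc i j l)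
    ·-assoc (rot i) (rot j) (ref l) = cong ref (⊕-assoc i j l)
    ·-assoc (rot i) (ref j) (rot l) = cong ref (⊕-⊖-assoc i j l)
    ·-assoc (rot i) (ref j) (ref l) = cong rot (⊕-⊖-assoc i j l)
    ·-assoc (ref i) (rot j) (rot l) = cong ref (⊖-⊕ i j l)
    ·-assoc (ref i) (rot j) (ref l) = cong rot (⊖-⊕ i j l)
    ·-assoc (ref i) (ref j) (rot l) = cong rot (⊖-⊖ i j l)
    ·-assoc (ref i) (ref j) (ref l) = cong ref (⊖-⊖ i j l)

    ·-identityˡ : ∀ x → e · x ≡ x
    ·-identityˡ (rot i) = cong rot (⊕-identityˡ i)
    ·-identityˡ (ref i) = cong ref (⊕-identityˡ i)

    ·-identityʳ : ∀ x → x · e ≡ x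
    ·-identityʳ (rot i) = cong rot (⊕-identityʳ i)
    ·-identityʳ (ref i) = cong ref (trans (cong (i ⊕_) ⊝0) (⊕-identityʳ i))

    inv-inverseˡ : ∀ x → inv x · x ≡ e
    inv-inverseˡ (rot i) = cong rot (⊝-inverseˡ i)
    inv-inverseˡ (ref i) = cong rot (⊝-inverseʳ i)

    inv-inverseʳ : ∀ x → x · inv x ≡ e
    inv-inverseʳ (rot i) = cong rot (⊝-inverseʳ i)
    inv-inverseʳ (ref i) = cong rot (⊝-inverseʳ i)

  dihedralGroup : Group 0ℓ 0ℓ
  dihedralGroup = record
    { Carrier = Dihedral k
    ; _≈_ = _≡_
    ; _∙_ = _·_
    ; ε = e
    ; _⁻¹ = inv
    ; isGroup = record
      { isMonoid = record
        { isSemigroup = record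
          { isMagma = record { isEquivalence = isEquivalence ; ∙-cong = cong₂ _·_ }
          ; assoc = ·-assoc
          }
        ; identity = ·-identityˡ , ·-identityʳ
        }
      ; inverse = inv-inverseˡ , inv-inverseʳ
      ; ⁻¹-cong = cong inv
      }
    }

  -- The defining relations; _×_ is iterated multiplication, i.e. x to the
  -- power m is m × x.
  module DihedralRelations where
    open Group dihedralGroup using (_∙_; ε; rawMonoid)
    open RawMonoidDefs rawMonoid using (_×_)

    r s : Dihedral k
    r = rot (1 mod k)
    s = ref 0#

    rotation-power : ∀ m → m × r ≡ rot (m mod k)
    rotation-power zero    = refl
    rotation-power (suc m) = begin
      r ∙ (m × r)                       ≡⟨ cong (r ∙_) (rotation-power m) ⟩
      rot ((1 mod k) ⊕ (m mod k))       ≡⟨ cong rot (mod-+ 1 m) ⟨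
      rot (suc m mod k)                 ∎

    rᵏ≡e : k × r ≡ ε
    rᵏ≡e = trans (rotation-power k) (cong rot k-mod)

    rot-s : ∀ i → rot i ∙ s ≡ ref i
    rot-s i = cong ref (⊕-identityʳ i)

    reflection-involutive : ∀ i → ref i ∙ ref i ≡ ε
    reflection-involutive i = cong rot (⊝-inverseʳ i)

    rⁱs≡sr⁻ⁱ : ∀ i → rot i ∙ s ≡ s ∙ rot (⊝ i)
    rⁱs≡sr⁻ⁱ i = cong ref (begin
      i ⊕ 0#           ≡⟨ ⊕-comm i 0# ⟩
      0# ⊕ i           ≡⟨ cong (0# ⊕_) (⊝-involutive i) ⟨
      0# ⊖ ⊝ i         ∎)

D : (k : ℕ) → .(3 ≤ k) → Group 0ℓ 0ℓ
D k 3≤k = dihedralGroup k {{>-nonZero (≤-trans (s≤s z≤n) 3≤k)}}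

private
  variable
    c ℓ : Level

-- That Γ has order n² is implied by the bijectivity of the entries.
record SemiMagicSquare (Γ : Group c ℓ) (n : ℕ) : Set (c ⊔ ℓ) where
  open Group Γ using (Carrier; _≈_; rawMonoid)
  open RawMonoidDefs rawMonoid using () renaming (sum to product)
  field
    entry             : Fin n → Fin n → Carrier
    entries-bijective : Bijective _≡_ _≈_ (uncurry entry)
    μ                 : Carrier
    row-product       : ∀ i → Σ[ σ ∈ Permutation′ n ] product (λ t → entry i (σ ⟨$⟩ʳ t)) ≈ μ
    column-product    : ∀ j → Σ[ σ ∈ Permutation′ n ] product (λ t → entry (σ ⟨$⟩ʳ t) j) ≈ μ

-- Let m = n / 2, h = m² and k = 2h.  For a ≠ -a the 2 × 2 block with rows
-- (rᵃ, r⁻ᵃs) and (rᵃs, r⁻ᵃ) has entries whose product, in a suitable order,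
-- is s along every row and column; such blocks, one for each pair {a, -a} with
-- a ≠ -a, would fill the whole array if 0 and h were not their own negatives.
-- The four exponents 0, h and the three pairs {±1}, {±(h-1)}, {±2} are
-- therefore put together in a 4 × 4 corner all of whose lines have product e
-- (this uses only 1 + (h-1) = h and 2h = 0).  Every line of the array then has
-- product s^m = s^(m-2).  All 2k elements occur, so by counting each occurs once.
module Submission where

open import Defs
open import Algebra.Bundles using (Group)
import Algebra.Definitions.RawMonoid as RawMonoidDefs
import Algebra.Properties.AbelianGroup as AbelianGroupProperties
import Algebra.Properties.Monoid.Sum as MonoidSum
open import Data.Fin.Base
  using (Fin; zero; suc; toℕ; fromℕ<; combine; remQuot; splitAt; join; punchIn; punchOut; _↑ˡ_; _↑ʳ_)
open import Data.Fin.Patterns using (0F; 1F; 2F)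
open import Data.Fin.Permutation
  using (Permutation′; _⟨$⟩ʳ_; insert; insert-punchIn; cast-id)
  renaming (id to idₚ)
open import Data.Fin.Properties
  using (_≟_; any?; punchOut-injective; injective⇒≤; remQuot-combine; combine-remQuot; join-splitAt;
         toℕ-fromℕ<; toℕ<n; +↔⊎; *↔×)
open import Data.Nat.Base
  using (ℕ; zero; suc; _+_; _*_; _^_; _∸_; _≤_; _<_; z≤n; s≤s; NonZero)
open import Data.Nat.Divisibility using (_∣_; divides; m∣m*n)
open import Data.Nat.DivMod using (_mod_)
open import Data.Nat.Primality using (prime?; euclidsLemma)
open import Data.Nat.Properties
  using (*-monoʳ-≤; *-identityʳ; 1+n≰n; <⇒≤; <-cmp; m<n⇒0<n∸m; m+n∸m≡n; ∸-monoʳ-<; m<1+n⇒m<n∨m≡n)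
open import Data.Nat.Solver using (module +-*-Solver)
open import Data.Product.Base using (_×_; _,_; Σ-syntax; ∃-syntax; uncurry; proj₁; proj₂)
open import Data.Sum.Base using (inj₁; inj₂; [_,_]′)
open import Function.Base using (_∘_; id)
open import Function.Bundles using (_⇔_; _↔_; mk⇔; mk↔ₛ′; Inverse)
open import Function.Construct.Composition using (_↔-∘_)
open import Function.Construct.Symmetry using (↔-sym)
open import Function.Definitions using (Injective; Bijective)
open import Relation.Binary.Definitions using (tri<; tri≈; tri>)
open import Relation.Binary.PropositionalEquality
  using (_≡_; refl; sym; trans; cong; cong₂; subst; module ≡-Reasoning)
open import Relation.Nullary using (yes; no; contradiction)
open import Relation.Nullary.Decidable using (from-yes)

open ≡-Reasoning

-- Surjections between finite sets of equal size.

injective⇒covering : ∀ {n} (g : Fin n → Fin n) → Injective _≡_ _≡_ g → ∀ y → ∃[ x ] g x ≡ y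
injective⇒covering {suc n} g g-inj y with any? (λ x → g x ≟ y)
... | yes hit  = hit
-- Punching a missed `y` out of every value would inject `Fin (suc n)` into `Fin n`.
... | no  miss = contradiction (injective⇒≤ punched-inj) 1+n≰n
  where
  y≢g : ∀ x → y ≡ g x → _
  y≢g x eq = miss (x , sym eq)

  punched-inj : Injective _≡_ _≡_ (λ x → punchOut (y≢g x))
  punched-inj {x} {x′} eq = g-inj (punchOut-injective (y≢g x) (y≢g x′) eq)

-- A section is injective, hence onto by counting, so every `x` has the form `g y`, where the claim
-- follows from `fg y`.
section⇒retraction : ∀ {n} {A B : Set} → A ↔ Fin n → B ↔ Fin n →
  (f : A → B) (g : B → A) → (∀ y → f (g y) ≡ y) → ∀ x → g (f x) ≡ x
section⇒retraction {n} A↔ B↔ f g fg x = subst (λ x → g (f x) ≡ x) gy≡x (cong g (fg y))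
  where
  module A = Inverse A↔
  module B = Inverse B↔

  g′ : Fin n → Fin n
  g′ i = A.to (g (B.from i))

  fg′ : ∀ i → B.to (f (A.from (g′ i))) ≡ i
  fg′ i = begin
    B.to (f (A.from (g′ i)))   ≡⟨ cong (B.to ∘ f) (A.strictlyInverseʳ _) ⟩
    B.to (f (g (B.from i)))    ≡⟨ cong B.to (fg _) ⟩
    B.to (B.from i)            ≡⟨ B.strictlyInverseˡ i ⟩
    i                          ∎

  preimage : ∃[ i ] g′ i ≡ A.to x
  preimage = injective⇒covering g′
    (λ {i} {j} eq → trans (sym (fg′ i)) (trans (cong (B.to ∘ f ∘ A.from) eq) (fg′ j))) (A.to x)

  y : _
  y = B.from (proj₁ preimage)

  gy≡x : g y ≡ x
  gy≡x = begin
    g y                 ≡⟨ A.strictlyInverseʳ (g y) ⟨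
    A.from (A.to (g y)) ≡⟨ cong A.from (proj₂ preimage) ⟩
    A.from (A.to x)     ≡⟨ A.strictlyInverseʳ x ⟩
    x                   ∎

-- Lets occurrence of every element suffice, with no two entries compared: the chosen preimages form
-- a left inverse of `f`.
surjective⇒bijective : ∀ {n} {A B : Set} → A ↔ Fin n → B ↔ Fin n →
  (f : A → B) → (∀ y → ∃[ x ] f x ≡ y) → Bijective _≡_ _≡_ f
surjective⇒bijective A↔ B↔ f surj =
  (λ {x} {x′} eq → trans (sym (gf x)) (trans (cong (proj₁ ∘ surj) eq) (gf x′))) ,
  (λ y → proj₁ (surj y) , λ { refl → proj₂ (surj y) })
  where
  gf = section⇒retraction A↔ B↔ f (proj₁ ∘ surj) (proj₂ ∘ surj)

Dihedral↔Fin : ∀ k → Dihedral k ↔ Fin (k + k)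
Dihedral↔Fin k = ↔-sym +↔⊎ ↔-∘ mk↔ₛ′
  (λ { (rot i) → inj₁ i ; (ref i) → inj₂ i }) [ rot , ref ]′
  (λ { (inj₁ i) → refl ; (inj₂ i) → refl })
  (λ { (rot i) → refl ; (ref i) → refl })

-- The square of side `2m`.

module Array
  (q k : ℕ) .{{_ : NonZero k}}
  (k≡h+h : k ≡ (4 + (2 * q + q * (2 + q))) + (4 + (2 * q + q * (2 + q))))
  where

  open ℤmod k
  open Group (dihedralGroup k)
    using (_∙_; ε; monoid; rawMonoid; assoc; identityˡ)
  open MonoidSum monoid using () renaming (sum to product; sum-cong-≗ to product-cong)
  open RawMonoidDefs rawMonoid using () renaming (_×_ to _⊗_)
  open AbelianGroupProperties abelianGroup using (x∙y⁻¹≈ε⇒x≈y)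

  m h h′ : ℕ
  m  = 2 + q
  -- The number of blocks outside the corner: `2q` to its right and `q * m` below. Hence `h` is the
  -- square of `m`.
  h′ = 2 * q + q * m
  h  = 4 + h′

  -- Rearranging the factors of a line.

  Arrangeable : ∀ {n} → (Fin n → Dihedral k) → Dihedral k → Set
  Arrangeable {n} f x = Σ[ σ ∈ Permutation′ n ] product (λ t → f (σ ⟨$⟩ʳ t)) ≡ x

  -- `insert 0F i σ` sends position 0 to `i` and the later positions to the other indices,
  -- renumbered through `punchIn i`.
  pick : ∀ {n} (f : Fin (suc n) → Dihedral k) i {x} →
    Arrangeable (f ∘ punchIn i) x → Arrangeable f (f i ∙ x)
  pick f i (σ , refl) =
    insert 0F i σ , cong (f i ∙_) (product-cong (λ t → cong f (insert-punchIn 0F i σ t)))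

  grid : ∀ {l} → (Fin l → Fin 2 → Dihedral k) → Fin (l * 2) → Dihedral k
  grid F t = uncurry F (remQuot 2 t)

  arrange-pairs : ∀ {l} (F : Fin l → Fin 2 → Dihedral k) {g} →
    (∀ j → F j 0F ∙ F j 1F ≡ g) → Arrangeable (grid F) (l ⊗ g)
  arrange-pairs {zero}  F eq = idₚ , refl
  arrange-pairs {suc l} F eq =
    subst (Arrangeable (grid F)) (trans (sym (assoc _ _ _)) (cong (_∙ _) (eq 0F)))
      (pick (grid F) 0F (pick (grid F ∘ suc) 0F (arrange-pairs (F ∘ suc) (eq ∘ suc))))

  arrange-swapped-pairs : ∀ {l} (F : Fin l → Fin 2 → Dihedral k) {g} →
    (∀ j → F j 1F ∙ F j 0F ≡ g) → Arrangeable (grid F) (l ⊗ g)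
  arrange-swapped-pairs {zero}  F eq = idₚ , refl
  arrange-swapped-pairs {suc l} F eq =
    subst (Arrangeable (grid F)) (trans (sym (assoc _ _ _)) (cong (_∙ _) (eq 0F)))
      (pick (grid F) 1F (pick (grid F ∘ punchIn 1F) 0F (arrange-swapped-pairs (F ∘ suc) (eq ∘ suc))))

  involution-cancel : ∀ {w x y z u p} → w ∙ x ≡ u → y ∙ z ≡ u → u ∙ u ≡ ε →
    w ∙ (x ∙ (y ∙ (z ∙ p))) ≡ p
  involution-cancel {w} {x} {y} {z} {u} {p} wx yz uu = begin
    w ∙ (x ∙ (y ∙ (z ∙ p)))   ≡⟨ assoc w x _ ⟨
    (w ∙ x) ∙ (y ∙ (z ∙ p))   ≡⟨ cong₂ _∙_ wx (trans (sym (assoc y z p)) (cong (_∙ p) yz)) ⟩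
    u ∙ (u ∙ p)               ≡⟨ assoc u u p ⟨
    (u ∙ u) ∙ p               ≡⟨ cong (_∙ p) uu ⟩
    ε ∙ p                     ≡⟨ identityˡ p ⟩
    p                         ∎

  -- Both pairs multiply to the same `u` of square `ε`, so the four factors cancel. Each index
  -- counts among the positions still left, and the fourth factor is the first of these.
  pick-two-pairs : ∀ {n} (f : Fin (4 + n) → Dihedral k) i₁ i₂ i₃ {u p} →
    let f₁ = f ∘ punchIn i₁ ; f₂ = f₁ ∘ punchIn i₂ ; f₃ = f₂ ∘ punchIn i₃ in
    f i₁ ∙ f₁ i₂ ≡ u → f₂ i₃ ∙ f₃ 0F ≡ u → u ∙ u ≡ ε →
    Arrangeable (f₃ ∘ suc) p → Arrangeable f p
  pick-two-pairs f i₁ i₂ i₃ wx yz uu rest =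
    subst (Arrangeable f) (involution-cancel wx yz uu)
      (pick f i₁ (pick f₁ i₂ (pick f₂ i₃ (pick f₃ 0F rest))))
    where
    f₁ = f ∘ punchIn i₁
    f₂ = f₁ ∘ punchIn i₂
    f₃ = f₂ ∘ punchIn i₃

  -- Blocks and the corner.

  square : {A : Set} → A → A → A → A → Fin 2 → Fin 2 → A
  square w x y z 0F 0F = w
  square w x y z 0F 1F = x
  square w x y z 1F 0F = y
  square w x y z 1F 1F = z

  block : Fin k → Fin 2 → Fin 2 → Dihedral k
  block x = square (rot x) (ref (⊝ x)) (ref x) (rot (⊝ x))

  a b c H : Fin k
  a = 1 mod k
  b = (3 + h′) mod k
  c = 2 mod k
  H = h mod k

  -- Labels run through 3, ..., `h - 2`: the exponents between 0 and `h` other than 1, 2 and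
  -- `h - 1`, which are those of `a`, `c` and `b`.
  label : Fin h′ → Fin k
  label p = (3 + toℕ p) mod k

  -- With R for `rot` and S for `ref`, the corner rows are R0, SH, S(-a), Rb; S0, RH, S(-b), R(-a);
  -- Rc, S(-c), Sa, Ra; Sc, R(-c), Sb, R(-b). The third column has only reflections and the fourth
  -- only rotations.
  cell : Fin m → Fin 2 → Fin m → Fin 2 → Dihedral k
  cell 0F r 0F t                 = square (rot 0#) (ref H) (ref 0#) (rot H) r t
  cell 0F r 1F t                 = square (ref (⊝ a)) (rot b) (ref (⊝ b)) (rot (⊝ a)) r t
  cell 1F r 0F t                 = block c r t
  cell 1F r 1F t                 = square (ref a) (rot a) (ref b) (rot (⊝ b)) r t
  cell 0F r (suc (suc j)) t      = block (label (combine {2} {q} 0F j ↑ˡ (q * m))) r t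
  cell 1F r (suc (suc j)) t      = block (label (combine {2} {q} 1F j ↑ˡ (q * m))) r t
  cell (suc (suc i)) r j t       = block (label ((2 * q) ↑ʳ combine i j)) r t

  entry : Fin (m * 2) → Fin (m * 2) → Dihedral k
  entry x y = uncurry (uncurry cell (remQuot 2 x)) (remQuot 2 y)

  entry-combine : ∀ i r j t → entry (combine i r) (combine j t) ≡ cell i r j t
  entry-combine i r j t = cong₂ (λ x y → uncurry (uncurry cell x) y) (remQuot-combine i r) (remQuot-combine j t)

  -- Products of rows and columns.

  H⊕H : H ⊕ H ≡ 0#
  H⊕H = begin
    H ⊕ H          ≡⟨ mod-+ h h ⟨
    (h + h) mod k  ≡⟨ cong (_mod k) k≡h+h ⟨
    k mod k        ≡⟨ k-mod ⟩
    0#             ∎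

  ⊝H : ⊝ H ≡ H
  ⊝H = sym (x∙y⁻¹≈ε⇒x≈y H (⊝ H) (trans (cong (H ⊕_) (⊝-involutive H)) H⊕H))

  a⊕b : a ⊕ b ≡ H
  a⊕b = sym (mod-+ 1 (3 + h′))

  -- Makes the pair from `a` and `b` in each of the first two rows multiply to `ref H`, like the
  -- pair from 0 and `H` beside it.
  ⊝a⊖b : ⊝ a ⊖ b ≡ H
  ⊝a⊖b = begin
    ⊝ a ⊖ b     ≡⟨ ⊝-⊕-comm a b ⟩
    ⊝ (a ⊕ b)   ≡⟨ cong ⊝_ a⊕b ⟩
    ⊝ H         ≡⟨ ⊝H ⟩
    H           ∎

  s μ₀ : Dihedral k
  s  = ref 0#
  μ₀ = q ⊗ s

  ref-involutive : ∀ x → ref x ∙ ref x ≡ ε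
  ref-involutive x = cong rot (⊝-inverseʳ x)

  -- Reconciles lines made of `m` pairs with lines through the corner, where only the `q` pairs
  -- beyond it contribute.
  m⊗s : m ⊗ s ≡ μ₀
  m⊗s = begin
    s ∙ (s ∙ μ₀)   ≡⟨ assoc s s μ₀ ⟨
    (s ∙ s) ∙ μ₀   ≡⟨ cong (_∙ μ₀) (ref-involutive 0#) ⟩
    ε ∙ μ₀         ≡⟨ identityˡ μ₀ ⟩
    μ₀             ∎

  block-row₀ : ∀ x → rot x ∙ ref (⊝ x) ≡ s
  block-row₀ x = cong ref (⊝-inverseʳ x)

  block-row₁ : ∀ x → rot (⊝ x) ∙ ref x ≡ s
  block-row₁ x = cong ref (⊝-inverseˡ x)

  block-col : ∀ x → ref x ∙ rot x ≡ s
  block-col x = cong ref (⊝-inverseʳ x)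

  -- The upper row of a block gives `s` in reading order and the lower one in reverse, so ordinary
  -- and swapped pairs alternate.
  row-arrangeable : ∀ i r → Arrangeable (grid (cell i r)) μ₀
  row-arrangeable 0F 0F =
    pick-two-pairs (grid (cell 0F 0F)) 0F 0F 0F (cong ref (⊕-identityˡ H)) (cong ref ⊝a⊖b) (ref-involutive H)
      (arrange-pairs {q} (λ j → cell 0F 0F (suc (suc j))) (λ j → block-row₀ _))
  row-arrangeable 0F 1F =
    pick-two-pairs (grid (cell 0F 1F)) 1F 0F 1F (cong ref (⊕-identityʳ H)) (cong ref ⊝a⊖b) (ref-involutive H)
      (arrange-swapped-pairs {q} (λ j → cell 0F 1F (suc (suc j))) (λ j → block-row₁ _))
  row-arrangeable 1F 0F =
    pick-two-pairs (grid (cell 1F 0F)) 0F 0F 0F (block-row₀ c) (block-col a) (ref-involutive 0#)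
      (arrange-pairs {q} (λ j → cell 1F 0F (suc (suc j))) (λ j → block-row₀ _))
  row-arrangeable 1F 1F =
    pick-two-pairs (grid (cell 1F 1F)) 1F 0F 1F (block-row₁ c) (block-row₁ b) (ref-involutive 0#)
      (arrange-swapped-pairs {q} (λ j → cell 1F 1F (suc (suc j))) (λ j → block-row₁ _))
  row-arrangeable (suc (suc i)) 0F =
    subst (Arrangeable (grid (cell (suc (suc i)) 0F))) m⊗s
      (arrange-pairs (cell (suc (suc i)) 0F) (λ j → block-row₀ _))
  row-arrangeable (suc (suc i)) 1F =
    subst (Arrangeable (grid (cell (suc (suc i)) 1F))) m⊗s
      (arrange-swapped-pairs (cell (suc (suc i)) 1F) (λ j → block-row₁ _))

  column : Fin m → Fin 2 → Fin m → Fin 2 → Dihedral k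
  column j t i r = cell i r j t

  -- The cases share one proof; splitting on `i` lets `cell` reduce.
  column₀-pairs : ∀ j i → column (suc (suc j)) 0F i 1F ∙ column (suc (suc j)) 0F i 0F ≡ s
  column₀-pairs j 0F            = block-col _
  column₀-pairs j 1F            = block-col _
  column₀-pairs j (suc (suc i)) = block-col _

  column₁-pairs : ∀ j i → column (suc (suc j)) 1F i 0F ∙ column (suc (suc j)) 1F i 1F ≡ s
  column₁-pairs j 0F            = block-col _
  column₁-pairs j 1F            = block-col _
  column₁-pairs j (suc (suc i)) = block-col _

  column-arrangeable : ∀ j t → Arrangeable (grid (column j t)) μ₀
  column-arrangeable 0F 0F =
    pick-two-pairs (grid (column 0F 0F)) 0F 0F 1F (cong ref (⊕-identityˡ 0#)) (block-col c) (ref-involutive 0#)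
      (arrange-swapped-pairs {q} (λ i → column 0F 0F (suc (suc i))) (λ i → block-col _))
  column-arrangeable 0F 1F =
    pick-two-pairs (grid (column 0F 1F)) 0F 0F 0F (block-col H) (block-col (⊝ c)) (ref-involutive 0#)
      (arrange-pairs {q} (λ i → column 0F 1F (suc (suc i))) (λ i → block-col _))
  -- The reflections have exponents -a, -b, a, b. Pairing -a with b and -b with a gives `rot H`
  -- twice.
  column-arrangeable 1F 0F =
    pick-two-pairs (grid (column 1F 0F)) 0F 2F 0F (cong rot ⊝a⊖b) (cong rot ⊝b⊖a) (cong rot H⊕H)
      (arrange-swapped-pairs {q} (λ i → column 1F 0F (suc (suc i))) (λ i → block-col _))
    where
    ⊝b⊖a : ⊝ b ⊖ a ≡ H
    ⊝b⊖a = trans (⊕-comm (⊝ b) (⊝ a)) ⊝a⊖b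
  -- The rotations b, -a, a, -b cancel in inverse pairs, so `u` is `ε`.
  column-arrangeable 1F 1F =
    pick-two-pairs (grid (column 1F 1F)) 0F 2F 0F (cong rot (⊝-inverseʳ b)) (cong rot (⊝-inverseˡ a)) (identityˡ ε)
      (arrange-pairs {q} (λ i → column 1F 1F (suc (suc i))) (λ i → block-col _))
  column-arrangeable (suc (suc j)) 0F =
    subst (Arrangeable (grid (column (suc (suc j)) 0F))) m⊗s
      (arrange-swapped-pairs (column (suc (suc j)) 0F) (column₀-pairs j))
  column-arrangeable (suc (suc j)) 1F =
    subst (Arrangeable (grid (column (suc (suc j)) 1F))) m⊗s
      (arrange-pairs (column (suc (suc j)) 1F) (column₁-pairs j))

  -- Every group element occurs.

  Occurs : Dihedral k → Set
  Occurs x = ∃[ xy ] uncurry entry xy ≡ x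

  BothOccur : Fin k → Set
  BothOccur x = Occurs (rot x) × Occurs (ref x)

  occurs : ∀ {x} i r j t → cell i r j t ≡ x → Occurs x
  occurs i r j t eq = (combine i r , combine j t) , trans (entry-combine i r j t) eq

  block-occurs : ∀ {x} i j → (∀ r t → cell i r j t ≡ block x r t) →
    BothOccur x × BothOccur (⊝ x)
  block-occurs i j eq =
    (occurs i 0F j 0F (eq 0F 0F) , occurs i 1F j 0F (eq 1F 0F)) ,
    (occurs i 1F j 1F (eq 1F 1F) , occurs i 0F j 1F (eq 0F 1F))

  -- `splitAt` decides between the strip right of the corner and the rows below; `remQuot` recovers
  -- the block.
  label-occurs : ∀ p → BothOccur (label p) × BothOccur (⊝ label p)
  label-occurs p with splitAt (2 * q) p in eq
  ... | inj₁ x = upper (proj₁ (remQuot {2} q x)) (proj₂ (remQuot {2} q x)) (begin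
        combine (proj₁ (remQuot {2} q x)) (proj₂ (remQuot {2} q x)) ↑ˡ (q * m)
          ≡⟨ cong (_↑ˡ (q * m)) (combine-remQuot {2} q x) ⟩
        x ↑ˡ (q * m)
          ≡⟨ cong (join (2 * q) (q * m)) eq ⟨
        join (2 * q) (q * m) (splitAt (2 * q) p)
          ≡⟨ join-splitAt (2 * q) (q * m) p ⟩
        p ∎)
    where
    upper : ∀ i j → combine i j ↑ˡ (q * m) ≡ p → BothOccur (label p) × BothOccur (⊝ label p)
    upper 0F j refl = block-occurs 0F (suc (suc j)) (λ _ _ → refl)
    upper 1F j refl = block-occurs 1F (suc (suc j)) (λ _ _ → refl)
  ... | inj₂ y = block-occurs (suc (suc (proj₁ (remQuot {q} m y)))) (proj₂ (remQuot {q} m y))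
        (λ r t → cong (λ p → block (label p) r t) (begin
        (2 * q) ↑ʳ combine (proj₁ (remQuot {q} m y)) (proj₂ (remQuot {q} m y))
          ≡⟨ cong ((2 * q) ↑ʳ_) (combine-remQuot {q} m y) ⟩
        (2 * q) ↑ʳ y
          ≡⟨ cong (join (2 * q) (q * m)) eq ⟨
        join (2 * q) (q * m) (splitAt (2 * q) p)
          ≡⟨ join-splitAt (2 * q) (q * m) p ⟩
        p ∎))

  -- Exponents 1, 2 and `h - 1` are found in the corner, the rest among the labels. Negatives are
  -- included because they supply the exponents above `h`.
  ±mod-occurs : ∀ l → 0 < l → l < h → BothOccur (l mod k) × BothOccur (⊝ (l mod k))
  ±mod-occurs 1 _ _ =
    (occurs 1F 0F 1F 1F refl , occurs 1F 0F 1F 0F refl) ,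
    (occurs 0F 1F 1F 1F refl , occurs 0F 0F 1F 0F refl)
  ±mod-occurs 2 _ _ = block-occurs 1F 0F (λ _ _ → refl)
  ±mod-occurs (suc (suc (suc l))) _ (s≤s (s≤s (s≤s l<1+h′))) with m<1+n⇒m<n∨m≡n l<1+h′
  -- The exponent is `3 + h′`, that of `b`.
  ... | inj₂ refl =
    (occurs 0F 0F 1F 1F refl , occurs 1F 1F 1F 0F refl) ,
    (occurs 1F 1F 1F 1F refl , occurs 0F 1F 1F 0F refl)
  ... | inj₁ l<h′ = subst (λ l → BothOccur ((3 + l) mod k) × BothOccur (⊝ ((3 + l) mod k)))
    (toℕ-fromℕ< l<h′) (label-occurs (fromℕ< l<h′))

  mod-occurs : ∀ l → l < h → BothOccur (l mod k)
  mod-occurs zero    _   = occurs 0F 0F 0F 0F refl , occurs 0F 1F 0F 0F refl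
  mod-occurs (suc l) l<h = proj₁ (±mod-occurs (suc l) (s≤s z≤n) l<h)

  both-occur : ∀ x → BothOccur x
  both-occur x with <-cmp (toℕ x) h
  ... | tri< x<h _ _ = subst BothOccur (mod-toℕ x) (mod-occurs (toℕ x) x<h)
  ... | tri≈ _ x≡h _ = subst BothOccur (trans (cong (_mod k) (sym x≡h)) (mod-toℕ x))
    (occurs 0F 1F 0F 1F refl , occurs 0F 0F 0F 1F refl)
  -- Here `x` is the negative of `k ∸ toℕ x`, which lies strictly between 0 and `h`.
  ... | tri> _ _ h<x = subst BothOccur (⊝-involutive x)
    (proj₂ (±mod-occurs (k ∸ toℕ x) (m<n⇒0<n∸m (toℕ<n x)) k∸x<h))
    where
    k∸x<h : k ∸ toℕ x < h
    k∸x<h = subst (k ∸ toℕ x <_) (trans (cong (_∸ h) k≡h+h) (m+n∸m≡n h h))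
      (∸-monoʳ-< h<x (<⇒≤ (toℕ<n x)))

  entry-surjective : ∀ x → Occurs x
  entry-surjective (rot x) = proj₁ (both-occur x)
  entry-surjective (ref x) = proj₂ (both-occur x)

  size : m * 2 * (m * 2) ≡ k + k
  size = trans (solve 1 (λ q → (con 2 :+ q) :* con 2 :* ((con 2 :+ q) :* con 2) :=
      (hₚ q :+ hₚ q) :+ (hₚ q :+ hₚ q)) refl q)
    (sym (cong₂ _+_ k≡h+h k≡h+h))
    where
    open +-*-Solver
    hₚ : ∀ {n} → Polynomial n → Polynomial n
    hₚ q = con 4 :+ (con 2 :* q :+ q :* (con 2 :+ q))

  semiMagicSquare : SemiMagicSquare (dihedralGroup k) (m * 2)
  semiMagicSquare = record
    { entry             = entry
    ; entries-bijective = surjective⇒bijective (cast-id size ↔-∘ ↔-sym *↔×) (Dihedral↔Fin k)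
                            (uncurry entry) entry-surjective
    ; μ                 = μ₀
    -- Rows and columns of `entry` unfold to `grid (cell i r)` and `grid (column j t)`.
    ; row-product       = λ x → row-arrangeable (proj₁ (remQuot {m} 2 x)) (proj₂ (remQuot {m} 2 x))
    ; column-product    = λ y → column-arrangeable (proj₁ (remQuot {m} 2 y)) (proj₂ (remQuot {m} 2 y))
    }

-- Parity and size of the side, and the equivalence.

2∣n²⇒2∣n : ∀ n k → 2 * k ≡ n ^ 2 → 2 ∣ n
2∣n²⇒2∣n n k eq = [ id , id ]′ (euclidsLemma n n (from-yes (prime? 2))
  (subst (2 ∣_) (trans eq (cong (n *_) (*-identityʳ n))) (m∣m*n k)))

-- The even numbers below 4 have squares 0 and 4, both less than 6.
order≥6⇒side≥4 : ∀ n k → 3 ≤ k → 2 * k ≡ n ^ 2 → 2 ∣ n → 4 ≤ n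
order≥6⇒side≥4 n k 3≤k eq (divides 0 refl) = contradiction (subst (6 ≤_) eq (*-monoʳ-≤ 2 3≤k)) λ ()
order≥6⇒side≥4 n k 3≤k eq (divides 1 refl) =
  contradiction (subst (6 ≤_) eq (*-monoʳ-≤ 2 3≤k)) λ { (s≤s (s≤s (s≤s (s≤s ())))) }
order≥6⇒side≥4 n k 3≤k eq (divides (suc (suc _)) refl) = s≤s (s≤s (s≤s (s≤s z≤n)))

theorem6p1 : (n : ℕ) .{{_ : NonZero n}} →
    (∃[ k ] Σ[ 3≤k ∈ 3 ≤ k ] (2 * k ≡ n ^ 2 × SemiMagicSquare (D k 3≤k) n)) ⇔ (2 ∣ n × 4 ≤ n)
theorem6p1 n = mk⇔ necessary sufficient
  where
  necessary : ∃[ k ] Σ[ 3≤k ∈ 3 ≤ k ] (2 * k ≡ n ^ 2 × SemiMagicSquare (D k 3≤k) n) → 2 ∣ n × 4 ≤ n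
  necessary (k , 3≤k , 2k≡n² , _) =
    2∣n²⇒2∣n n k 2k≡n² , order≥6⇒side≥4 n k 3≤k 2k≡n² (2∣n²⇒2∣n n k 2k≡n²)

  sufficient : 2 ∣ n × 4 ≤ n → ∃[ k ] Σ[ 3≤k ∈ 3 ≤ k ] (2 * k ≡ n ^ 2 × SemiMagicSquare (D k 3≤k) n)
  sufficient (divides 0 refl , ())
  sufficient (divides 1 refl , s≤s (s≤s ()))
  sufficient (divides (suc (suc q)) refl , _) =
    -- With `n` twice `2 + q`, the order forces `k` to be twice the square of `2 + q`.
    h + h , s≤s (s≤s (s≤s z≤n)) , solve 1 (λ q →
      con 2 :* (hₚ q :+ hₚ q) := ((con 2 :+ q) :* con 2) :^ 2) refl q ,
    Array.semiMagicSquare q (h + h) refl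
    where
    h : ℕ
    h = 4 + (2 * q + q * (2 + q))

    open +-*-Solver
    hₚ : ∀ {n} → Polynomial n → Polynomial n
    hₚ q = con 4 :+ (con 2 :* q :+ q :* (con 2 :+ q))
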